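{- For every graph $G$, $$\kappa(G\times K_2)=\min\{2\kappa(G),\,b(G)\}.$$
   Context: All graphs are finite, undirected, without loops or multiple edges (and have at least one vertex). The connectivity $\kappa(G)$ of a graph $G$ is the fewest number of vertices whose removal from $G$ results in a disconnected or trivial (one-vertex) graph. $K_2$ is the complete graph on two vertices. The Kronecker (direct) product $G_1\times G_2$ of graphs $G_1,G_2$ has vertex set $V(G_1)\times V(G_2)$, with $(u_1,v_1)$ and $(u_2,v_2)$ adjacent if and only if $u_1u_2\in E(G_1)$ and $v_1v_2\in E(G_2)$. For $W\subseteq V(G)$, $G[W]$ is the subgraph induced by $W$ and $G-W$ is the graph obtained by deleting the vertices of $W$. A one-vertex graph counts as bipartite. Let $X,Y\subseteq V(G)$ be two disjoint sets (possibly empty) with $V(G)-(X\cup Y)\neq\emptyset$. The ordered pair $(X,Y)$ is called a b-pair of $G$ if $G-(X\cup Y)$ has a bipartite connected component $C$ such that $G[V(C)\cup\{x\}]$ is also bipartite for each $x\in X$. Define $b(G)=\min\{|X|+2|Y| : (X,Y)\text{ is a b-pair of }G\}$. -}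

module Defs where

open import Data.Bool.Base using (Bool; true)
import Data.Bool.Properties as Bool
open import Data.Fin.Base using (Fin; fromℕ<; remQuot)
open import Data.Fin.Properties as Fin using (any?; all?)
open import Data.Fin.Subset
open import Data.Fin.Subset.Properties
open import Data.List.Base using (List; []; _∷_; allFin)
open import Data.List.Membership.Propositional using () renaming (_∈_ to _∈ˡ_)
open import Data.List.Membership.Propositional.Properties using (∈-allFin)
open import Data.List.Relation.Unary.Any using (here; there)
open import Data.Nat.Base as ℕ using (ℕ; zero; suc; _+_; _*_; _≤_; z≤n; s≤s; NonZero)
import Data.Nat.Properties as ℕ
open import Data.Product.Base using (∃; ∃₂; _×_; _,_; proj₁; proj₂)
open import Data.Product.Relation.Binary.Pointwise.NonDependent using (Pointwise; ×-decidable; ×-symmetric)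
open import Data.Sum.Base using (_⊎_; inj₁; inj₂; [_,_]′)
open import Data.Vec.Base using (lookup; tabulate)
open import Data.Vec.Properties using (lookup∘tabulate)
open import Function.Base using (_∘_; _on_)
open import Function.Bundles using (_⇔_; mk⇔; module Equivalence)
open import Level using (0ℓ)
open import Relation.Binary.Construct.Closure.ReflexiveTransitive using (Star; ε; _◅_; _◅◅_)
open import Relation.Binary.Core using (Rel)
open import Relation.Binary.Definitions using (Decidable; Symmetric; Irreflexive)
open import Relation.Binary.PropositionalEquality
open import Relation.Nullary using (yes; no; ¬_; contradiction)
open import Relation.Nullary.Decidable using (map′; ¬?; _×-dec_; _⊎-dec_; _→-dec_)
open import Relation.Unary using (Pred) renaming (Decidable to Decidable₁)

record Graph : Set₁ where
  infix 4 _~_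
  field
    order     : ℕ
    {{order≢0}} : NonZero order
    _~_       : Rel (Fin order) 0ℓ
    _~?_      : Decidable _~_
    ~-sym     : Symmetric _~_
    ~-irrefl  : Irreflexive _≡_ _~_

  Vertex : Set
  Vertex = Fin order

K₂ : Graph
K₂ = record
  { order    = 2
  ; _~_      = _≢_
  ; _~?_     = λ x y → ¬? (x Fin.≟ y)
  ; ~-sym    = λ x≢y → x≢y ∘ sym
  ; ~-irrefl = λ x≡y x≢y → x≢y x≡y
  }

-- Vertices of the product are pairs, encoded by the bijection
-- remQuot : Fin (m * n) → Fin m × Fin n.

infixl 7 _⊗_

_⊗_ : Graph → Graph → Graph
G ⊗ H = record
  { order    = G.order * H.order
  ; order≢0  = ℕ.m*n≢0 G.order H.order
  ; _~_      = Pointwise G._~_ H._~_ on remQuot H.order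
  ; _~?_     = λ x y → ×-decidable G._~?_ H._~?_ (remQuot H.order x) (remQuot H.order y)
  ; ~-sym    = ×-symmetric {R = G._~_} {S = H._~_} G.~-sym H.~-sym
  ; ~-irrefl = λ { refl (u~u , _) → G.~-irrefl refl u~u }
  }
  where
  module G = Graph G
  module H = Graph H

Least : Pred ℕ 0ℓ → Pred ℕ 0ℓ
Least P k = P k × (∀ {j} → P j → k ≤ j)

least : ∀ {P : Pred ℕ 0ℓ} → Decidable₁ P → ∀ m → P m → ∃ (Least P)
least P? zero p = zero , p , λ _ → z≤n
least {P} P? (suc m) p with P? zero
... | yes p₀ = zero , p₀ , λ _ → z≤n
... | no ¬p₀ with least {P ∘ suc} (P? ∘ suc) m p
...   | k , pₖ , k≤ = suc k , pₖ , λ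
          { {zero}  q → contradiction q ¬p₀
          ; {suc _} q → s≤s (k≤ q)
          }

module _ {n} {R : Rel (Fin n) 0ℓ} (R? : Decidable R) where

  private
    -- Warshall's algorithm: paths whose interior vertices all lie in the given list.
    Via : List (Fin n) → Rel (Fin n) 0ℓ
    Via []       x y = x ≡ y ⊎ R x y
    Via (v ∷ vs) x y = Via vs x y ⊎ (Via vs x v × Via vs v y)

    via? : ∀ vs → Decidable (Via vs)
    via? []       x y = (x Fin.≟ y) ⊎-dec R? x y
    via? (v ∷ vs) x y = via? vs x y ⊎-dec (via? vs x v ×-dec via? vs v y)

    via⇒star : ∀ vs {x y} → Via vs x y → Star R x y
    via⇒star []       (inj₁ refl)    = ε
    via⇒star []       (inj₂ r)       = r ◅ ε
    via⇒star (v ∷ vs) (inj₁ p)       = via⇒star vs p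
    via⇒star (v ∷ vs) (inj₂ (p , q)) = via⇒star vs p ◅◅ via⇒star vs q

    lift : ∀ vs {x y} → x ≡ y ⊎ R x y → Via vs x y
    lift []       p = p
    lift (v ∷ vs) p = inj₁ (lift vs p)

    join : ∀ {vs m x y} → m ∈ˡ vs → Via vs x m → Via vs m y → Via vs x y
    join (here refl) p q = inj₂ ([ (λ a → a) , proj₁ ]′ p , [ (λ b → b) , proj₂ ]′ q)
    join (there m∈) (inj₁ p)       (inj₁ q)       = inj₁ (join m∈ p q)
    join (there m∈) (inj₁ p)       (inj₂ (q , r)) = inj₂ (join m∈ p q , r)
    join (there m∈) (inj₂ (p , q)) (inj₁ r)       = inj₂ (p , join m∈ q r)
    join (there m∈) (inj₂ (p , _)) (inj₂ (_ , r)) = inj₂ (p , r)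

    star⇒via : ∀ {x y} → Star R x y → Via (allFin n) x y
    star⇒via ε        = lift (allFin n) (inj₁ refl)
    star⇒via (r ◅ rs) = join (∈-allFin _) (lift (allFin n) (inj₂ r)) (star⇒via rs)

  star? : Decidable (Star R)
  star? x y = map′ (via⇒star (allFin n)) star⇒via (via? (allFin n) x y)

-- A subset S of the vertices stands for the induced subgraph G[S], so that
-- G - W is ∁ W; a component is represented by its vertex set.
module _ (G : Graph) where
  open Graph G

  Adj : Subset order → Rel Vertex 0ℓ
  Adj S x y = x ∈ S × y ∈ S × x ~ y

  -- Meaningful for x ∈ S: there is a walk from x to y in G[S].
  Reach : Subset order → Rel Vertex 0ℓ
  Reach S = Star (Adj S)

  Connected : Pred (Subset order) 0ℓ
  Connected S = ∀ x y → x ∈ S → y ∈ S → Reach S x y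

  Trivial : Pred (Subset order) 0ℓ
  Trivial S = ∣ S ∣ ≡ 1

  IsComponent : Subset order → Pred (Subset order) 0ℓ
  IsComponent S C = ∃ λ x → x ∈ S × (∀ y → y ∈ C ⇔ Reach S x y)

  -- Colours assigned outside S are irrelevant.
  Bipartite : Pred (Subset order) 0ℓ
  Bipartite S = ∃ λ (c : Vertex → Bool) → ∀ x y → Adj S x y → c x ≢ c y

  adj? : ∀ S → Decidable (Adj S)
  adj? S x y = (x ∈? S) ×-dec (y ∈? S) ×-dec (x ~? y)

  reach? : ∀ S → Decidable (Reach S)
  reach? S = star? (adj? S)

  connected? : Decidable₁ Connected
  connected? S = all? λ x → all? λ y → (x ∈? S) →-dec ((y ∈? S) →-dec reach? S x y)

  isComponent? : ∀ S → Decidable₁ (IsComponent S)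
  isComponent? S C = any? λ x → (x ∈? S) ×-dec all? λ y →
    map′ (λ (f , g) → mk⇔ f g) (λ e → Equivalence.to e , Equivalence.from e)
      (((y ∈? C) →-dec reach? S x y) ×-dec (reach? S x y →-dec (y ∈? C)))

  bipartite? : Decidable₁ Bipartite
  bipartite? S = map′
    (λ (A , p) → lookup A , p)
    (λ (c , p) → tabulate c , λ x y a eq → p x y a
      (trans (sym (lookup∘tabulate c x)) (trans eq (lookup∘tabulate c y))))
    (anySubset? λ A → all? λ x → all? λ y →
      adj? S x y →-dec ¬? (lookup A x Bool.≟ lookup A y))

  private
    v₀ : Vertex
    v₀ = fromℕ< (ℕ.>-nonZero⁻¹ order)

    ∁∁⁅v₀⁆ : ∁ (∁ ⁅ v₀ ⁆) ≡ ⁅ v₀ ⁆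
    ∁∁⁅v₀⁆ = ⊆-antisym (λ x∈ → x∉∁p⇒x∈p (x∈∁p⇒x∉p x∈)) (λ x∈ → x∉p⇒x∈∁p (x∈p⇒x∉∁p x∈))

  -- The empty set is Connected and not Trivial, so W never contains all
  -- the vertices.
  IsCut : Pred (Subset order) 0ℓ
  IsCut W = ¬ Connected (∁ W) ⊎ Trivial (∁ W)

  isCut? : Decidable₁ IsCut
  isCut? W = ¬? (connected? (∁ W)) ⊎-dec (∣ ∁ W ∣ ℕ.≟ 1)

  CutSize : Pred ℕ 0ℓ
  CutSize k = ∃ λ W → IsCut W × ∣ W ∣ ≡ k

  κ-least : ∃ (Least CutSize)
  κ-least = least
    (λ k → anySubset? λ W → isCut? W ×-dec (∣ W ∣ ℕ.≟ k))
    _ (∁ ⁅ v₀ ⁆ , inj₂ (trans (cong ∣_∣ ∁∁⁅v₀⁆) (∣⁅x⁆∣≡1 v₀)) , refl)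

  κ : ℕ
  κ = proj₁ κ-least

  IsBPair : Subset order → Subset order → Set
  IsBPair X Y =
    Empty (X ∩ Y) ×
    Nonempty (∁ (X ∪ Y)) ×
    ∃ λ C → IsComponent (∁ (X ∪ Y)) C × Bipartite C ×
            (∀ x → x ∈ X → Bipartite (C ∪ ⁅ x ⁆))

  isBPair? : Decidable IsBPair
  isBPair? X Y =
    ¬? (nonempty? (X ∩ Y)) ×-dec
    nonempty? (∁ (X ∪ Y)) ×-dec
    anySubset? λ C → isComponent? (∁ (X ∪ Y)) C ×-dec bipartite? C ×-dec
                     all? λ x → (x ∈? X) →-dec bipartite? (C ∪ ⁅ x ⁆)

  BPairSize : Pred ℕ 0ℓ
  BPairSize k = ∃₂ λ X Y → IsBPair X Y × ∣ X ∣ + 2 * ∣ Y ∣ ≡ k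

  private
    S₀≡ : ∁ (⊥ ∪ ∁ ⁅ v₀ ⁆) ≡ ⁅ v₀ ⁆
    S₀≡ = trans (cong ∁ (∪-identityˡ (∁ ⁅ v₀ ⁆))) ∁∁⁅v₀⁆

    v₀-component : IsComponent ⁅ v₀ ⁆ ⁅ v₀ ⁆
    v₀-component = v₀ , x∈⁅x⁆ v₀ , λ y → mk⇔
      (λ y∈ → subst (Reach ⁅ v₀ ⁆ v₀) (sym (x∈⁅y⁆⇒x≡y v₀ y∈)) ε)
      (stays (x∈⁅x⁆ v₀))
      where
      stays : ∀ {x y} → x ∈ ⁅ v₀ ⁆ → Reach ⁅ v₀ ⁆ x y → y ∈ ⁅ v₀ ⁆
      stays x∈ ε                    = x∈
      stays x∈ ((_ , z∈ , _) ◅ rs) = stays z∈ rs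

    v₀-bipartite : Bipartite ⁅ v₀ ⁆
    v₀-bipartite = (λ _ → true) , λ x y (x∈ , y∈ , x~y) _ →
      ~-irrefl (trans (x∈⁅y⁆⇒x≡y v₀ x∈) (sym (x∈⁅y⁆⇒x≡y v₀ y∈))) x~y

    bPair₀ : IsBPair ⊥ (∁ ⁅ v₀ ⁆)
    bPair₀ =
      (λ (_ , x∈) → ∉⊥ (proj₁ (x∈p∩q⁻ ⊥ _ x∈))) ,
      (v₀ , subst (v₀ ∈_) (sym S₀≡) (x∈⁅x⁆ v₀)) ,
      ⁅ v₀ ⁆ , subst (λ S → IsComponent S ⁅ v₀ ⁆) (sym S₀≡) v₀-component ,
      v₀-bipartite , λ x x∈⊥ → contradiction x∈⊥ ∉⊥

  b-least : ∃ (Least BPairSize)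
  b-least = least
    (λ k → anySubset? λ X → anySubset? λ Y →
      isBPair? X Y ×-dec (∣ X ∣ + 2 * ∣ Y ∣ ℕ.≟ k))
    _ (⊥ , ∁ ⁅ v₀ ⁆ , bPair₀ , refl)

  b : ℕ
  b = proj₁ b-least

{-# OPTIONS --safe #-}
-- A vertex v of G has two copies in G × K₂. A b-pair (X , Y) with component C
-- yields a cut of size |X| + 2|Y|: remove both copies of each y ∈ Y and one copy
-- of each x ∈ X, chosen so that one of the two components of C × K₂ gets detached.
-- Conversely, let W disconnect G × K₂ into two sides; let Y be the vertices with
-- both copies in W, X those with exactly one copy in W, and S the rest.
-- If some x ∈ X has no neighbour in S, then (X - x , Y) is a b-pair with C = {x}.
-- If the copies of some v ∈ S lie on different sides, then the same holds
-- throughout the component of v in G[S], and the side of the lower copy is a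
-- 2-colouring making (X , Y) a b-pair. Otherwise each side s contains both
-- copies of some vertex of S, so Y together with the x ∈ X whose surviving copy
-- is on side s is a cut of G, and the sizes of these two cuts add up to |W|.

module Submission where

open import Data.Bool.Base using (Bool; true; false; not; _xor_; if_then_else_)
import Data.Bool.Properties as Bool
open import Data.Fin.Base using (Fin; zero; suc; combine; remQuot)
open import Data.Fin.Properties as Fin using (any?; combine-surjective; combine-injectiveˡ; combine-injectiveʳ;
  remQuot-combine)
open import Data.Fin.Patterns using (0F; 1F)
open import Data.Fin.Subset
open import Data.Fin.Subset.Properties
open import Data.Nat.Base using (ℕ; zero; suc; _+_; _*_; _⊓_; _≤_; _<_)
import Data.Nat.Properties as ℕ
open import Data.Nat.Solver using (module +-*-Solver)
open import Data.Product.Base using (∃; ∃₂; _×_; _,_; proj₁; proj₂)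
open import Data.Product.Relation.Binary.Pointwise.NonDependent using (Pointwise)
open import Data.Sum.Base using (_⊎_; inj₁; inj₂; [_,_]′)
open import Data.Vec.Base using ([]; _∷_; here; there; lookup; tabulate; zipWith)
open import Data.Vec.Properties using (lookup∘tabulate; tabulate∘lookup; tabulate-cong; lookup-zipWith;
  []=⇒lookup; lookup⇒[]=)
open import Function.Base using (_∘_; id)
open import Function.Bundles using (mk⇔; module Equivalence)
open import Level using (Level; 0ℓ)
open import Relation.Binary.Construct.Closure.ReflexiveTransitive using (Star; ε; _◅_; _◅◅_; fold)
open import Relation.Binary.Core using (Rel)
open import Relation.Binary.PropositionalEquality
open import Relation.Nullary using (does; yes; no; ¬_; contradiction)
open import Relation.Nullary.Decidable using (¬?; _×-dec_; decidable-stable; dec-true; dec-false; does-⇔)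
open import Relation.Unary using (Pred; Decidable)
open import Defs
open +-*-Solver using (solve; con; _:+_; _:*_; _:=_)

private
  variable
    a r ℓ : Level
    n : ℕ

-- Comprehension and counting for finite subsets.

module _ {P : Pred (Fin n) ℓ} (P? : Decidable P) where

  select : Subset n
  select = tabulate (does ∘ P?)

  ∈-select⁺ : ∀ {x} → P x → x ∈ select
  ∈-select⁺ {x} px = lookup⇒[]= x select
    (trans (lookup∘tabulate (does ∘ P?) x) (dec-true (P? x) px))

  ∈-select⁻ : ∀ {x} → x ∈ select → P x
  ∈-select⁻ {x} x∈ = decidable-stable (P? x) λ ¬px →
    contradiction
      (trans (sym (dec-false (P? x) ¬px)) (trans (sym (lookup∘tabulate (does ∘ P?) x)) ([]=⇒lookup x∈)))
      λ ()

x∉p-x : (p : Subset n) (x : Fin n) → x ∉ p - x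
x∉p-x (_ ∷ p) (suc x) (there x∈) = x∉p-x p x x∈

∣p∣+∣∁p∣≡n : (p : Subset n) → ∣ p ∣ + ∣ ∁ p ∣ ≡ n
∣p∣+∣∁p∣≡n p = trans (cong (∣ p ∣ +_) (∣∁p∣≡n∸∣p∣ p)) (ℕ.m+[n∸m]≡n (∣p∣≤n p))

∣p∣≡1⇒singleton : {p : Subset n} → ∣ p ∣ ≡ 1 → ∃ λ x → x ∈ p × (∀ {y} → y ∈ p → y ≡ x)
∣p∣≡1⇒singleton {n} {p} ∣p∣≡1 with nonempty? p
... | no p-empty =
  contradiction (trans (sym ∣p∣≡1) (trans (cong ∣_∣ (Empty-unique p-empty)) (∣⊥∣≡0 n))) λ ()
... | yes (x , x∈p) = x , x∈p , λ {y} y∈p → decidable-stable (y Fin.≟ x) λ y≢x →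
  ℕ.n≮0 (ℕ.<-≤-trans (x∈p⇒∣p-x∣<∣p∣ (x∈p∧x≢y⇒x∈p-y y∈p y≢x))
                     (ℕ.≤-pred (subst (∣ p - x ∣ <_) ∣p∣≡1 (x∈p⇒∣p-x∣<∣p∣ x∈p))))

private
  +-suc-double : ∀ {p q r s} → p + q ≡ r + 2 * s → suc p + suc q ≡ r + 2 * suc s
  +-suc-double {p} {q} {r} {s} eq = begin
    suc p + suc q     ≡⟨ cong suc (ℕ.+-suc p q) ⟩
    2 + (p + q)       ≡⟨ cong (2 +_) eq ⟩
    2 + (r + 2 * s)   ≡⟨ solve 2 (λ r s → con 2 :+ (r :+ con 2 :* s) := r :+ con 2 :* (con 1 :+ s)) refl r s ⟩
    r + 2 * suc s     ∎
    where open ≡-Reasoning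

  +-sucʳ : ∀ {p q r} → p + q ≡ r → p + suc q ≡ suc r
  +-sucʳ {p} {q} eq = trans (ℕ.+-suc p q) (cong suc eq)

-- The symmetric difference `zipWith _xor_ p q` collects what is counted once, the intersection what
-- is counted twice. Applied to the two layers of a cut, this yields the weight of a b-pair.
∣p∣+∣q∣≡∣p⊕q∣+2∣p∩q∣ : (p q : Subset n) → ∣ p ∣ + ∣ q ∣ ≡ ∣ zipWith _xor_ p q ∣ + 2 * ∣ p ∩ q ∣
∣p∣+∣q∣≡∣p⊕q∣+2∣p∩q∣ []            []            = refl
∣p∣+∣q∣≡∣p⊕q∣+2∣p∩q∣ (outside ∷ p) (outside ∷ q) = ∣p∣+∣q∣≡∣p⊕q∣+2∣p∩q∣ p q
∣p∣+∣q∣≡∣p⊕q∣+2∣p∩q∣ (outside ∷ p) (inside  ∷ q) = +-sucʳ {∣ p ∣} (∣p∣+∣q∣≡∣p⊕q∣+2∣p∩q∣ p q)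
∣p∣+∣q∣≡∣p⊕q∣+2∣p∩q∣ (inside  ∷ p) (outside ∷ q) = cong suc (∣p∣+∣q∣≡∣p⊕q∣+2∣p∩q∣ p q)
∣p∣+∣q∣≡∣p⊕q∣+2∣p∩q∣ (inside  ∷ p) (inside  ∷ q) =
  +-suc-double {∣ p ∣} {∣ q ∣} {∣ zipWith _xor_ p q ∣} (∣p∣+∣q∣≡∣p⊕q∣+2∣p∩q∣ p q)

-- The common shape of two constructions: what a b-pair removes from layer `b` of the product, and
-- the two cuts of `G` extracted from a cut of the product. Each `x ∈ X` enters exactly one of the
-- two sets and `Y` enters both, whence the total size below.
part : Subset n → Subset n → (Fin n → Bool) → Bool → Subset n
part X Y f b = Y ∪ (X ∩ select λ x → f x Bool.≟ b)

∣part∣+∣part∣ : (X Y : Subset n) (f : Fin n → Bool) → Empty (X ∩ Y) →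
                ∣ part X Y f false ∣ + ∣ part X Y f true ∣ ≡ ∣ X ∣ + 2 * ∣ Y ∣
∣part∣+∣part∣ []            []            f X∩Y≡∅ = refl
∣part∣+∣part∣ (outside ∷ X) (outside ∷ Y) f X∩Y≡∅ = ∣part∣+∣part∣ X Y (f ∘ suc) (drop-∷-Empty X∩Y≡∅)
∣part∣+∣part∣ (outside ∷ X) (inside  ∷ Y) f X∩Y≡∅ =
  +-suc-double {∣ part X Y (f ∘ suc) false ∣} {∣ part X Y (f ∘ suc) true ∣} {∣ X ∣}
    (∣part∣+∣part∣ X Y (f ∘ suc) (drop-∷-Empty X∩Y≡∅))
∣part∣+∣part∣ (inside  ∷ X) (inside  ∷ Y) f X∩Y≡∅ = contradiction (zero , here) X∩Y≡∅
∣part∣+∣part∣ (inside  ∷ X) (outside ∷ Y) f X∩Y≡∅ with f zero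
... | false = cong suc (∣part∣+∣part∣ X Y (f ∘ suc) (drop-∷-Empty X∩Y≡∅))
... | true  = +-sucʳ {∣ part X Y (f ∘ suc) false ∣} (∣part∣+∣part∣ X Y (f ∘ suc) (drop-∷-Empty X∩Y≡∅))

Y⊆part : ∀ (X Y : Subset n) f b → Y ⊆ part X Y f b
Y⊆part X Y f b = p⊆p∪q _

∈-part⁺ : ∀ (X Y : Subset n) f {x b} → x ∈ X → f x ≡ b → x ∈ part X Y f b
∈-part⁺ X Y f {b = b} x∈X fx≡b =
  q⊆p∪q Y _ (x∈p∩q⁺ (x∈X , ∈-select⁺ (λ x → f x Bool.≟ b) fx≡b))

part⊆∪ : ∀ (X Y : Subset n) f b → part X Y f b ⊆ X ∪ Y
part⊆∪ X Y f b = [ q⊆p∪q X Y , p⊆p∪q Y ∘ p∩q⊆p X _ ]′ ∘ x∈p∪q⁻ Y _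

-- The two layers of the product with `K₂`.

index : Bool → Fin 2
index b = if b then 1F else 0F

infix 7 _at_

-- With Boolean names for the layers, `not` passes to the other layer, and `xor` compares layers
-- with colours and sides.
_at_ : Fin n → Bool → Fin (n * 2)
v at b = combine v (index b)

layer : ∀ n → Subset (n * 2) → Bool → Subset n
layer n W b = tabulate λ v → lookup W (v at b)

-- `combine` puts the two copies of a vertex next to each other, so each induction step peels two
-- entries off `W`.
∣W∣≡∣layer∣+∣layer∣ : ∀ n (W : Subset (n * 2)) → ∣ W ∣ ≡ ∣ layer n W false ∣ + ∣ layer n W true ∣
∣W∣≡∣layer∣+∣layer∣ zero    []                      = refl
∣W∣≡∣layer∣+∣layer∣ (suc n) (outside ∷ outside ∷ W) = ∣W∣≡∣layer∣+∣layer∣ n W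
∣W∣≡∣layer∣+∣layer∣ (suc n) (inside  ∷ outside ∷ W) = cong suc (∣W∣≡∣layer∣+∣layer∣ n W)
∣W∣≡∣layer∣+∣layer∣ (suc n) (outside ∷ inside  ∷ W) =
  sym (+-sucʳ {∣ layer n W false ∣} (sym (∣W∣≡∣layer∣+∣layer∣ n W)))
∣W∣≡∣layer∣+∣layer∣ (suc n) (inside  ∷ inside  ∷ W) =
  cong suc (sym (+-sucʳ {∣ layer n W false ∣} (sym (∣W∣≡∣layer∣+∣layer∣ n W))))

index-≢ : ∀ b → index b ≢ index (not b)
index-≢ false ()
index-≢ true  ()

at-surjective : (i : Fin (n * 2)) → ∃₂ λ (v : Fin n) b → v at b ≡ i
at-surjective {n} i with combine-surjective {n} {2} i
... | v , 0F , refl = v , false , refl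
... | v , 1F , refl = v , true  , refl

private
  entry : (Bool → Subset n) → Fin n × Fin 2 → Bool
  entry L (v , 0F) = lookup (L false) v
  entry L (v , 1F) = lookup (L true) v

layered : (Bool → Subset n) → Subset (n * 2)
layered {n} L = tabulate (entry L ∘ remQuot {n} 2)

lookup-layered : (L : Bool → Subset n) → ∀ v b → lookup (layered L) (v at b) ≡ lookup (L b) v
lookup-layered {n} L v false = trans (lookup∘tabulate _ (v at false))
  (cong (entry L) (remQuot-combine {n} {2} v 0F))
lookup-layered {n} L v true  = trans (lookup∘tabulate _ (v at true))
  (cong (entry L) (remQuot-combine {n} {2} v 1F))

∈-layered⁺ : (L : Bool → Subset n) → ∀ {v} b → v ∈ L b → v at b ∈ layered L
∈-layered⁺ L {v} b v∈ = lookup⇒[]= _ _ (trans (lookup-layered L v b) ([]=⇒lookup v∈))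

∈-layered⁻ : (L : Bool → Subset n) → ∀ {v} b → v at b ∈ layered L → v ∈ L b
∈-layered⁻ L {v} b v∈ = lookup⇒[]= _ _ (trans (sym (lookup-layered L v b)) ([]=⇒lookup v∈))

∣layered∣ : (L : Bool → Subset n) → ∣ layered L ∣ ≡ ∣ L false ∣ + ∣ L true ∣
∣layered∣ {n} L = trans (∣W∣≡∣layer∣+∣layer∣ n (layered L))
  (cong₂ (λ p q → ∣ p ∣ + ∣ q ∣) (layer-layered false) (layer-layered true))
  where
  layer-layered : ∀ b → layer n (layered L) b ≡ L b
  layer-layered b = trans (tabulate-cong (λ v → lookup-layered L v b)) (tabulate∘lookup (L b))

-- Walks, components and 2-colourings.

Star-closed : {A : Set a} {R : Rel A r} {P : Pred A ℓ} →
              (∀ {x y} → P x → R x y → P y) → ∀ {x y} → P x → Star R x y → P y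
Star-closed {P = P} step px xRy = fold (λ x y → P x → P y) (λ xRz k px → k (step px xRz)) id xRy px

module _ (G : Graph) where
  open Graph G

  κ-≤ : ∀ {W} → IsCut G W → κ G ≤ ∣ W ∣
  κ-≤ {W} cut = proj₂ (proj₂ (κ-least G)) (W , cut , refl)

  b-≤ : ∀ {X Y} → IsBPair G X Y → b G ≤ ∣ X ∣ + 2 * ∣ Y ∣
  b-≤ {X} {Y} bpair = proj₂ (proj₂ (b-least G)) (X , Y , bpair , refl)

  component : Subset order → Vertex → Subset order
  component S v = select (reach? G S v)

  isComponent-component : ∀ {S v} → v ∈ S → IsComponent G S (component S v)
  isComponent-component {S} {v} v∈S = v , v∈S , λ y → mk⇔ (∈-select⁻ (reach? G S v)) (∈-select⁺ (reach? G S v))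

  -- A property preserved along edges is preserved along walks, so a separation can be shown by an
  -- invariant set, without computing components.
  ¬connected : ∀ {S} (P : Pred Vertex 0ℓ) → (∀ {x y} → P x → Adj G S x y → P y) →
               ∀ {x y} → x ∈ S → y ∈ S → P x → ¬ P y → ¬ Connected G S
  ¬connected P step x∈S y∈S px ¬py conn = ¬py (Star-closed step px (conn _ _ x∈S y∈S))

  isolated⇒reach-≡ : ∀ {S v} → (∀ {y} → ¬ Adj G S v y) → ∀ {y} → Reach G S v y → v ≡ y
  isolated⇒reach-≡ iso ε       = refl
  isolated⇒reach-≡ iso (a ◅ _) = contradiction a iso

  bipartite-⁅⁆ : ∀ x → Bipartite G ⁅ x ⁆
  bipartite-⁅⁆ x = (λ _ → true) , λ y z (y∈ , z∈ , y~z) _ →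
    ~-irrefl (trans (x∈⁅y⁆⇒x≡y x y∈) (sym (x∈⁅y⁆⇒x≡y x z∈))) y~z

  -- The colouring singles out `x`, which also covers `x ≡ z`. It makes the condition on `X`
  -- automatic when the component of a b-pair is a single vertex.
  bipartite-pair : ∀ x z → Bipartite G (⁅ x ⁆ ∪ ⁅ z ⁆)
  bipartite-pair x z = (λ y → does (y Fin.≟ x)) , proper
    where
    in-z : ∀ {y} → y ∈ ⁅ x ⁆ ∪ ⁅ z ⁆ → y ≢ x → y ≡ z
    in-z y∈ y≢x with x∈p∪q⁻ ⁅ x ⁆ ⁅ z ⁆ y∈
    ... | inj₁ y∈x = contradiction (x∈⁅y⁆⇒x≡y x y∈x) y≢x
    ... | inj₂ y∈z = x∈⁅y⁆⇒x≡y z y∈z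

    proper : ∀ u v → Adj G (⁅ x ⁆ ∪ ⁅ z ⁆) u v → does (u Fin.≟ x) ≢ does (v Fin.≟ x)
    proper u v (u∈ , v∈ , u~v) with u Fin.≟ x | v Fin.≟ x
    ... | yes u≡x | yes v≡x = λ _ → ~-irrefl (trans u≡x (sym v≡x)) u~v
    ... | yes _   | no _    = λ ()
    ... | no _    | yes _   = λ ()
    ... | no u≢x  | no v≢x  = λ _ → ~-irrefl (trans (in-z u∈ u≢x) (sym (in-z v∈ v≢x))) u~v

  -- Both colourings flip along every edge, so their difference is constant along walks from the
  -- root `r`; `k` is its value there. This lets colourings chosen separately for each `C ∪ ⁅ x ⁆`
  -- be compared with one fixed colouring of `C`.
  component-colourings : ∀ {S C} → IsComponent G S C → {c d : Vertex → Bool} →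
    (∀ {x y} → Adj G C x y → c x ≢ c y) → (∀ {x y} → Adj G C x y → d x ≢ d y) →
    ∃ λ k → ∀ {v} → v ∈ C → d v ≡ k xor c v
  component-colourings {S} {C} (r , r∈S , C⇔) {c} {d} c-proper d-proper =
    k , λ v∈C → proj₂ (Star-closed step (from (C⇔ r) ε , k-root) (to (C⇔ _) v∈C))
    where
    open Equivalence
    k = d r xor c r

    k-root : d r ≡ k xor c r
    k-root = sym (trans (Bool.xor-assoc (d r) (c r) (c r))
      (trans (cong (d r xor_) (Bool.xor-same (c r))) (Bool.xor-identityʳ (d r))))

    step : ∀ {x y} → x ∈ C × d x ≡ k xor c x → Adj G S x y → y ∈ C × d y ≡ k xor c y
    step {x} {y} (x∈C , dx≡) a@(_ , _ , x~y) = y∈C , (begin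
      d y               ≡⟨ Bool.¬-not (d-proper (y∈C , x∈C , ~-sym x~y)) ⟩
      not (d x)         ≡⟨ cong not dx≡ ⟩
      not (k xor c x)   ≡⟨ Bool.not-distribʳ-xor k (c x) ⟩
      k xor not (c x)   ≡⟨ cong (k xor_) (Bool.¬-not (c-proper (y∈C , x∈C , ~-sym x~y))) ⟨
      k xor c y         ∎)
      where
      open ≡-Reasoning
      y∈C = from (C⇔ y) (to (C⇔ x) x∈C ◅◅ a ◅ ε)

-- Upper bound: cuts of the product from cuts and b-pairs of `G`.

module _ (G : Graph) where
  open Graph G

  infix 4 _~ᴷ_
  _~ᴷ_ = Graph._~_ (G ⊗ K₂)

  ~ᴷ⁺ : ∀ {u v} b → u ~ v → u at b ~ᴷ v at not b
  ~ᴷ⁺ {u} {v} b u~v = subst₂ (Pointwise _~_ _≢_) (sym (remQuot-combine u _)) (sym (remQuot-combine v _))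
    (u~v , index-≢ b)

  ~ᴷ⁻ : ∀ {u v} b c → u at b ~ᴷ v at c → u ~ v × c ≡ not b
  ~ᴷ⁻ {u} {v} b c adj with subst₂ (Pointwise _~_ _≢_) (remQuot-combine u _) (remQuot-combine v _) adj
  ... | u~v , b≢c = u~v , Bool.¬-not λ { refl → b≢c refl }

  -- Walks in the product project to walks in `G`, so a separation of `G` lifts. If only one vertex
  -- of `G` is left, its two copies are not adjacent, so the product is again disconnected rather
  -- than trivial.
  doubled-isCut : ∀ {W} → IsCut G W → IsCut (G ⊗ K₂) (layered λ _ → W)
  doubled-isCut {W} cut = inj₁ ([ from-disconnected , from-trivial ]′ cut)
    where
    S = ∁ (layered λ _ → W)

    ∈S⁺ : ∀ {v} b → v ∈ ∁ W → v at b ∈ S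
    ∈S⁺ b v∈ = x∉p⇒x∈∁p (x∈∁p⇒x∉p v∈ ∘ ∈-layered⁻ (λ _ → W) b)

    ∈S⁻ : ∀ {v} b → v at b ∈ S → v ∈ ∁ W
    ∈S⁻ b v∈ = x∉p⇒x∈∁p (x∈∁p⇒x∉p v∈ ∘ ∈-layered⁺ (λ _ → W) b)

    from-disconnected : ¬ Connected G (∁ W) → ¬ Connected (G ⊗ K₂) S
    from-disconnected ¬conn conn = ¬conn λ x y x∈ y∈ →
      below (conn (x at false) (y at false) (∈S⁺ false x∈) (∈S⁺ false y∈))
      where
      Below : Fin order → Fin (order * 2) → Set
      Below x i = ∃₂ λ v b → v at b ≡ i × Reach G (∁ W) x v

      step : ∀ {x i j} → Below x i → Adj (G ⊗ K₂) S i j → Below x j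
      step {j = j} (v , b , refl , x⇝v) (v∈ , w∈ , v~w) with at-surjective {order} j
      ... | w , c , refl = w , c , refl , (x⇝v ◅◅ (∈S⁻ b v∈ , ∈S⁻ c w∈ , proj₁ (~ᴷ⁻ b c v~w)) ◅ ε)

      below : ∀ {x y} → Reach (G ⊗ K₂) S (x at false) (y at false) → Reach G (∁ W) x y
      below {x} {y} p with Star-closed step (x , false , refl , ε) p
      ... | v , b , eq , x⇝v = subst (Reach G (∁ W) x) (combine-injectiveˡ v _ y _ eq) x⇝v

    from-trivial : Trivial G (∁ W) → ¬ Connected (G ⊗ K₂) S
    from-trivial ∣∁W∣≡1 conn with ∣p∣≡1⇒singleton ∣∁W∣≡1
    ... | v , v∈ , unique = contradiction
      (combine-injectiveʳ v 0F v 1F (isolated⇒reach-≡ (G ⊗ K₂) iso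
        (conn (v at false) (v at true) (∈S⁺ false v∈) (∈S⁺ true v∈))))
      λ ()
      where
      iso : ∀ {j} → ¬ Adj (G ⊗ K₂) S (v at false) j
      iso {j} (_ , w∈ , v~w) with at-surjective {order} j
      ... | w , c , refl = ~-irrefl (sym (unique (∈S⁻ c w∈))) (proj₁ (~ᴷ⁻ false c v~w))

  -- As `C` is connected and `C ∪ ⁅ x ⁆` is bipartite, all neighbours of `x` in `C` have the same
  -- colour. Hence only one copy of `x` is adjacent to a given half of the product of `C` with `K₂`,
  -- and removing that copy is enough.
  bPair-isCut : ∀ {X Y} → IsBPair G X Y → ∃ λ W → IsCut (G ⊗ K₂) W × ∣ W ∣ ≡ ∣ X ∣ + 2 * ∣ Y ∣
  bPair-isCut {X} {Y} (X∩Y≡∅ , _ , C , C-comp@(r , r∈S , C⇔) , (c , c-proper) , C∪x) =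
    layered L , inj₁ disconnected , trans (∣layered∣ L) (∣part∣+∣part∣ X Y cut-layer X∩Y≡∅)
    where
    open Equivalence
    S = ∁ (X ∪ Y)

    r∈C : r ∈ C
    r∈C = from (C⇔ r) ε

    C⊆S : ∀ {v} → v ∈ C → v ∈ S
    C⊆S v∈C = Star-closed (λ _ → proj₁ ∘ proj₂) r∈S (to (C⇔ _) v∈C)

    ∪-proper : ∀ {x} (x∈X : x ∈ X) {u v} → Adj G C u v → proj₁ (C∪x x x∈X) u ≢ proj₁ (C∪x x x∈X) v
    ∪-proper {x} x∈X (u∈ , v∈ , u~v) = proj₂ (C∪x x x∈X) _ _ (p⊆p∪q ⁅ x ⁆ u∈ , p⊆p∪q ⁅ x ⁆ v∈ , u~v)

    offset : ∀ {x} (x∈X : x ∈ X) → ∃ λ k → ∀ {v} → v ∈ C → proj₁ (C∪x x x∈X) v ≡ k xor c v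
    offset x∈X = component-colourings G C-comp (c-proper _ _) (∪-proper x∈X)

    -- The colour of `x` in its own colouring of `C ∪ ⁅ x ⁆`, shifted so that this colouring agrees
    -- with `c` on `C`.
    cut-layer : Vertex → Bool
    cut-layer x with x ∈? X
    ... | yes x∈X = proj₁ (offset x∈X) xor proj₁ (C∪x x x∈X) x
    -- A default value: `part` consults `cut-layer` only on `X`.
    ... | no  _   = false

    cut-layer-~ : ∀ {x v} → x ∈ X → v ∈ C → v ~ x → cut-layer x ≡ not (c v)
    cut-layer-~ {x} {v} x∈X v∈C v~x with x ∈? X
    ... | no x∉X = contradiction x∈X x∉X
    ... | yes x∈X = begin
      k xor d x                ≡⟨ cong (k xor_) (Bool.¬-not (d-proper x v
        (q⊆p∪q C ⁅ x ⁆ (x∈⁅x⁆ x) , p⊆p∪q ⁅ x ⁆ v∈C , ~-sym v~x))) ⟩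
      k xor not (d v)          ≡⟨ cong (λ t → k xor not t) (d≡ v∈C) ⟩
      k xor not (k xor c v)    ≡⟨ Bool.not-distribʳ-xor k _ ⟨
      not (k xor (k xor c v))  ≡⟨ cong not (Bool.xor-assoc k k (c v)) ⟨
      not ((k xor k) xor c v)  ≡⟨ cong (λ t → not (t xor c v)) (Bool.xor-same k) ⟩
      not (c v)                ∎
      where
      open ≡-Reasoning
      k = proj₁ (offset x∈X)
      d≡ = proj₂ (offset x∈X)
      d = proj₁ (C∪x x x∈X)
      d-proper = proj₂ (C∪x x x∈X)

    L = part X Y cut-layer

    C-at : ∀ {v} b → v ∈ C → v at b ∈ ∁ (layered L)
    C-at {v} b v∈C = x∉p⇒x∈∁p (x∈∁p⇒x∉p (C⊆S v∈C) ∘ part⊆∪ X Y cut-layer b ∘ ∈-layered⁻ L b)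

    -- One of the two components of the product of `C` with `K₂`: each vertex is taken in the layer
    -- given by its colour.
    Half : Pred (Fin (order * 2)) 0ℓ
    Half i = ∃ λ v → v ∈ C × v at c v ≡ i

    step : ∀ {i j} → Half i → Adj (G ⊗ K₂) (∁ (layered L)) i j → Half j
    step {j = j} (v , v∈C , refl) (_ , j∉L , v~j) with at-surjective {order} j
    ... | w , e , refl with ~ᴷ⁻ (c v) e v~j
    ... | v~w , refl with w ∈? Y | w ∈? X
    ... | yes w∈Y | _       =
      contradiction (∈-layered⁺ L (not (c v)) (Y⊆part X Y cut-layer _ w∈Y)) (x∈∁p⇒x∉p j∉L)
    ... | no _    | yes w∈X = contradiction
      (∈-layered⁺ L (not (c v)) (∈-part⁺ X Y cut-layer w∈X (cut-layer-~ w∈X v∈C v~w)))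
      (x∈∁p⇒x∉p j∉L)
    ... | no w∉Y  | no w∉X  = w , w∈C , cong (w at_) (Bool.¬-not (c-proper w v (w∈C , v∈C , ~-sym v~w)))
      where
      w∈C = from (C⇔ w) (to (C⇔ v) v∈C ◅◅ (C⊆S v∈C , x∉p⇒x∈∁p ([ w∉X , w∉Y ]′ ∘ x∈p∪q⁻ X Y) , v~w) ◅ ε)

    disconnected : ¬ Connected (G ⊗ K₂) (∁ (layered L))
    -- The two copies of the root `r` both survive, and exactly one of them lies in `Half`.
    disconnected = ¬connected (G ⊗ K₂) Half step (C-at (c r) r∈C) (C-at (not (c r)) r∈C) (r , r∈C , refl)
      λ (v , _ , eq) → at-≢ (combine-injectiveˡ v _ r _ eq) eq
      where
      at-≢ : ∀ {v} → v ≡ r → v at c v ≢ r at not (c r)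
      at-≢ refl eq = index-≢ (c r) (combine-injectiveʳ r _ r _ eq)

  -- Lower bound: a cut of the product seen through its two sides.

  module _ (W : Subset (order * 2)) (side : Vertex → Bool → Bool)
           (side-~ : ∀ {u v} b → u at b ∉ W → v at not b ∉ W → u ~ v → side u b ≡ side v (not b))
           (side-onto : ∀ s → ∃₂ λ v b → v at b ∉ W × side v b ≡ s)
           where

    private
      X Y S : Subset order
      X = zipWith _xor_ (layer order W false) (layer order W true)
      Y = layer order W false ∩ layer order W true
      S = ∁ (X ∪ Y)

      -- For v ∈ X ∪ S the layer of a surviving copy of v.
      alive : Vertex → Bool
      alive v = lookup W (v at false)

      lookup-X : ∀ v → lookup X v ≡ lookup W (v at false) xor lookup W (v at true)
      lookup-X v = trans (lookup-zipWith _xor_ v (layer order W false) (layer order W true))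
        (cong₂ _xor_ (lookup∘tabulate _ v) (lookup∘tabulate _ v))

      ∈-layer⁺ : ∀ {v} b → v at b ∈ W → v ∈ layer order W b
      ∈-layer⁺ {v} b v∈ = lookup⇒[]= v _ (trans (lookup∘tabulate _ v) ([]=⇒lookup v∈))

      ∈-layer⁻ : ∀ {v} b → v ∈ layer order W b → v at b ∈ W
      ∈-layer⁻ {v} b v∈ = lookup⇒[]= _ W (trans (sym (lookup∘tabulate _ v)) ([]=⇒lookup v∈))

      Y⇒removed : ∀ {v} b → v ∈ Y → v at b ∈ W
      Y⇒removed false v∈Y = ∈-layer⁻ false (p∩q⊆p _ _ v∈Y)
      Y⇒removed true  v∈Y = ∈-layer⁻ true (p∩q⊆q (layer order W false) _ v∈Y)

      -- If the lower copy is removed, `alive v` is `true`, and `v ∉ Y` keeps the upper copy;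
      -- otherwise `alive v` points to the lower copy itself.
      Y∌⇒alive : ∀ {v} → v ∉ Y → v at alive v ∉ W
      Y∌⇒alive {v} v∉Y v∈W with lookup W (v at false) in eq₀
      ... | false = contradiction (trans (sym eq₀) ([]=⇒lookup v∈W)) λ ()
      ... | true  = v∉Y (x∈p∩q⁺ (∈-layer⁺ false (lookup⇒[]= _ W eq₀) , ∈-layer⁺ true v∈W))

      S⇒lookup : ∀ {v} b → v ∈ S → lookup W (v at b) ≡ false
      S⇒lookup {v} b v∈S with lookup W (v at false) in eq₀ | lookup W (v at true) in eq₁
      S⇒lookup false v∈S | false | false = eq₀
      S⇒lookup true  v∈S | false | false = eq₁
      ... | true  | true  = contradiction
        (q⊆p∪q X Y (x∈p∩q⁺ (∈-layer⁺ false (lookup⇒[]= _ W eq₀) , ∈-layer⁺ true (lookup⇒[]= _ W eq₁))))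
        (x∈∁p⇒x∉p v∈S)
      ... | true  | false = contradiction
        (p⊆p∪q Y (lookup⇒[]= v X (trans (lookup-X v) (cong₂ _xor_ eq₀ eq₁)))) (x∈∁p⇒x∉p v∈S)
      ... | false | true  = contradiction
        (p⊆p∪q Y (lookup⇒[]= v X (trans (lookup-X v) (cong₂ _xor_ eq₀ eq₁)))) (x∈∁p⇒x∉p v∈S)

      S⇒survives : ∀ {v} b → v ∈ S → v at b ∉ W
      S⇒survives b v∈S v∈W = contradiction (trans (sym (S⇒lookup b v∈S)) ([]=⇒lookup v∈W)) λ ()

      S⁺ : ∀ {v} → v ∉ X → v ∉ Y → v ∈ S
      S⁺ v∉X v∉Y = x∉p⇒x∈∁p ([ v∉X , v∉Y ]′ ∘ x∈p∪q⁻ X Y)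

      X∩Y≡∅ : Empty (X ∩ Y)
      X∩Y≡∅ (v , v∈) with x∈p∩q⁻ X Y v∈
      ... | v∈X , v∈Y with lookup W (v at false) in eq₀ | lookup W (v at true) in eq₁
                         | trans (sym (lookup-X v)) ([]=⇒lookup v∈X)
      ... | true  | true  | ()
      ... | false | _     | _ = contradiction (trans (sym eq₀) ([]=⇒lookup (Y⇒removed false v∈Y))) λ ()
      ... | true  | false | _ = contradiction (trans (sym eq₁) ([]=⇒lookup (Y⇒removed true v∈Y))) λ ()

      ∣W∣≡∣X∣+2∣Y∣ : ∣ W ∣ ≡ ∣ X ∣ + 2 * ∣ Y ∣
      ∣W∣≡∣X∣+2∣Y∣ = trans (∣W∣≡∣layer∣+∣layer∣ order W)
        (∣p∣+∣q∣≡∣p⊕q∣+2∣p∩q∣ (layer order W false) (layer order W true))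

      -- Putting `x` back makes it a one-vertex component, and any two vertices induce a bipartite
      -- graph. With this case settled, every `x ∈ X` has a neighbour in `S`, which the pure case
      -- uses to find vertices of `S` on both sides.
      isolated-case : ∀ {x} → x ∈ X → (∀ {v} → v ∈ S → ¬ x ~ v) → b G ≤ ∣ W ∣
      isolated-case {x} x∈X iso = begin
        b G                     ≤⟨ b-≤ G bPair ⟩
        ∣ X - x ∣ + 2 * ∣ Y ∣   ≤⟨ ℕ.+-monoˡ-≤ (2 * ∣ Y ∣) (∣p─q∣≤∣p∣ X ⁅ x ⁆) ⟩
        ∣ X ∣ + 2 * ∣ Y ∣       ≡⟨ ∣W∣≡∣X∣+2∣Y∣ ⟨
        ∣ W ∣                   ∎
        where
        open ℕ.≤-Reasoning
        S′ = ∁ ((X - x) ∪ Y)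

        x∈S′ : x ∈ S′
        x∈S′ = x∉p⇒x∈∁p
          ([ x∉p-x X x , (λ x∈Y → X∩Y≡∅ (x , x∈p∩q⁺ (x∈X , x∈Y))) ]′ ∘ x∈p∪q⁻ (X - x) Y)

        S′-S : ∀ {v} → v ∈ S′ → v ≢ x → v ∈ S
        S′-S v∈S′ v≢x = S⁺ (λ v∈X → x∈∁p⇒x∉p v∈S′ (p⊆p∪q Y (x∈p∧x≢y⇒x∈p-y v∈X v≢x)))
                           (λ v∈Y → x∈∁p⇒x∉p v∈S′ (q⊆p∪q (X - x) Y v∈Y))

        reach-x : ∀ {v} → Reach G S′ x v → x ≡ v
        reach-x = isolated⇒reach-≡ G λ { (_ , v∈S′ , x~v) →
          iso (S′-S v∈S′ λ v≡x → ~-irrefl (sym v≡x) x~v) x~v }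

        bPair : IsBPair G (X - x) Y
        bPair =
          (λ { (v , v∈) → X∩Y≡∅ (v , x∈p∩q⁺ (p─q⊆p X ⁅ x ⁆ (p∩q⊆p _ Y v∈) , p∩q⊆q (X - x) Y v∈)) }) ,
          (x , x∈S′) ,
          ⁅ x ⁆ , (x , x∈S′ , λ v → mk⇔
            (λ v∈ → subst (Reach G S′ x) (sym (x∈⁅y⁆⇒x≡y x v∈)) ε)
            (λ x⇝v → subst (_∈ ⁅ x ⁆) (reach-x x⇝v) (x∈⁅x⁆ x))) ,
          bipartite-⁅⁆ G x , λ z _ → bipartite-pair G x z

      Mixed : Pred Vertex 0ℓ
      Mixed v = v ∈ S × side v false ≢ side v true

      -- On `S` this is the side of the lower copy. If only the upper copy survives, it is the
      -- opposite of that copy's side, as though the missing lower copy lay across from it.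
      colour : Vertex → Bool
      colour v = alive v xor side v (alive v)

      Mixed⇒side : ∀ {v} b → Mixed v → side v b ≡ b xor colour v
      Mixed⇒side {v} b (v∈S , sides≢) rewrite S⇒lookup false v∈S with b
      ... | false = refl
      ... | true  = Bool.¬-not (sides≢ ∘ sym)

      alive⇒side : ∀ v → side v (alive v) ≡ alive v xor colour v
      alive⇒side v = sym (trans (sym (Bool.xor-assoc (alive v) (alive v) _))
                                (cong (_xor side v (alive v)) (Bool.xor-same (alive v))))

      -- The copy of `v` opposite to `z at b` is on the same side as `z at b`, so equal colours
      -- would identify `b` with `not b`. Leaving `b` free covers both edges inside the component
      -- and edges to `X`, where `b` is `alive z`.
      colour-proper : ∀ {v z} b → Mixed v → z at b ∉ W → side z b ≡ b xor colour z → v ~ z →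
                      colour v ≢ colour z
      colour-proper {v} {z} b v-mixed z∉W side-z v~z c≡ = absurd b (colour z) (begin
        b xor colour z        ≡⟨ side-z ⟨
        side z b              ≡⟨ side-~ b z∉W (S⇒survives (not b) (proj₁ v-mixed)) (~-sym v~z) ⟩
        side v (not b)        ≡⟨ Mixed⇒side (not b) v-mixed ⟩
        not b xor colour v    ≡⟨ cong (not b xor_) c≡ ⟩
        not b xor colour z    ∎)
        where
        open ≡-Reasoning
        absurd : ∀ b c → b xor c ≢ not b xor c
        absurd false false ()
        absurd false true  ()
        absurd true  false ()
        absurd true  true  ()

      mixed-case : ∀ {v} → Mixed v → b G ≤ ∣ W ∣
      mixed-case {v} v-mixed@(v∈S , _) = subst (b G ≤_) (sym ∣W∣≡∣X∣+2∣Y∣) (b-≤ G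
        (X∩Y≡∅ , (v , v∈S) , C , isComponent-component G v∈S ,
         (colour , λ y z (y∈ , z∈ , y~z) → CC y∈ z∈ y~z) , λ x x∈X → colour , C∪x x∈X))
        where
        C = component G S v

        -- An edge `y ~ z` gives two product edges joining opposite layers, so the sides of `z` are
        -- those of `y` swapped.
        step : ∀ {y z} → Mixed y → Adj G S y z → Mixed z
        step {y} {z} (y∈S , y≢) (_ , z∈S , y~z) = z∈S , λ z≡ → y≢ (begin
          side y false   ≡⟨ side-~ false (S⇒survives false y∈S) (S⇒survives true z∈S) y~z ⟩
          side z true    ≡⟨ z≡ ⟨
          side z false   ≡⟨ side-~ true (S⇒survives true y∈S) (S⇒survives false z∈S) y~z ⟨
          side y true    ∎)
          where open ≡-Reasoning

        C⇒Mixed : ∀ {y} → y ∈ C → Mixed y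
        C⇒Mixed y∈C = Star-closed step v-mixed (∈-select⁻ (reach? G S v) y∈C)

        CC : ∀ {y z} → y ∈ C → z ∈ C → y ~ z → colour y ≢ colour z
        CC y∈C z∈C y~z = colour-proper false (C⇒Mixed y∈C) (S⇒survives false (proj₁ (C⇒Mixed z∈C)))
          (Mixed⇒side false (C⇒Mixed z∈C)) y~z

        CX : ∀ {y x} → y ∈ C → x ∈ X → y ~ x → colour y ≢ colour x
        CX {x = x} y∈C x∈X y~x = colour-proper (alive x) (C⇒Mixed y∈C)
          (Y∌⇒alive λ x∈Y → X∩Y≡∅ (x , x∈p∩q⁺ (x∈X , x∈Y))) (alive⇒side x) y~x

        C∪x : ∀ {x} → x ∈ X → ∀ y z → Adj G (C ∪ ⁅ x ⁆) y z → colour y ≢ colour z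
        C∪x {x} x∈X y z (y∈ , z∈ , y~z) with x∈p∪q⁻ C ⁅ x ⁆ y∈ | x∈p∪q⁻ C ⁅ x ⁆ z∈
        ... | inj₁ y∈C | inj₁ z∈C = CC y∈C z∈C y~z
        ... | inj₁ y∈C | inj₂ z∈x with refl ← x∈⁅y⁆⇒x≡y x z∈x = CX y∈C x∈X y~z
        ... | inj₂ y∈x | inj₁ z∈C with refl ← x∈⁅y⁆⇒x≡y x y∈x = CX z∈C x∈X (~-sym y~z) ∘ sym
        ... | inj₂ y∈x | inj₂ z∈x = contradiction y~z
          (~-irrefl (trans (x∈⁅y⁆⇒x≡y x y∈x) (sym (x∈⁅y⁆⇒x≡y x z∈x))))

      -- Once `Z s` is removed, the vertices of `S` on side `s` have neighbours only among
      -- themselves, and vertices of `S` on the other side remain. So `Z false` and `Z true` are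
      -- both cuts of `G`.
      pure-case : (∀ {x} → x ∈ X → ∃ λ v → v ∈ S × x ~ v) → (∀ {v} → v ∈ S → side v false ≡ side v true) →
                  2 * κ G ≤ ∣ W ∣
      pure-case X-neighbour pure = begin
        2 * κ G                          ≡⟨ cong (κ G +_) (ℕ.+-identityʳ (κ G)) ⟩
        κ G + κ G                        ≤⟨ ℕ.+-mono-≤ (κ-≤ G (Z-isCut false)) (κ-≤ G (Z-isCut true)) ⟩
        ∣ Z false ∣ + ∣ Z true ∣         ≡⟨ ∣part∣+∣part∣ X Y σ X∩Y≡∅ ⟩
        ∣ X ∣ + 2 * ∣ Y ∣                ≡⟨ ∣W∣≡∣X∣+2∣Y∣ ⟨
        ∣ W ∣                            ∎
        where
        open ℕ.≤-Reasoning

        σ : Vertex → Bool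
        σ x = side x (alive x)

        Z = part X Y σ

        pure⁺ : ∀ {v} b c → v ∈ S → side v b ≡ side v c
        pure⁺ false false v∈S = refl
        pure⁺ false true  v∈S = pure v∈S
        pure⁺ true  false v∈S = sym (pure v∈S)
        pure⁺ true  true  v∈S = refl

        S-onto : ∀ s → ∃ λ v → v ∈ S × side v false ≡ s
        S-onto s with side-onto s
        ... | v , b , v∉W , refl with v ∈? X
        ... | no v∉X  = v , v∈S , pure⁺ false b v∈S
          where v∈S = S⁺ v∉X λ v∈Y → v∉W (Y⇒removed b v∈Y)
        -- A witness in `X` is traded for a neighbour in `S`, whose copy in the other layer is on
        -- the same side.
        ... | yes v∈X with X-neighbour v∈X
        ... | w , w∈S , v~w = w , w∈S ,
          trans (pure⁺ false (not b) w∈S) (sym (side-~ b v∉W (S⇒survives (not b) w∈S) v~w))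

        S⊆∁Z : ∀ s {v} → v ∈ S → v ∈ ∁ (Z s)
        S⊆∁Z s v∈S = x∉p⇒x∈∁p (x∈∁p⇒x∉p v∈S ∘ part⊆∪ X Y σ s)

        Z-isCut : ∀ s → IsCut G (Z s)
        Z-isCut s with S-onto s | S-onto (not s)
        ... | u , u∈S , u-side | v , v∈S , v-side = inj₁ (¬connected G
          (λ y → y ∈ S × side y false ≡ s) step (S⊆∁Z s u∈S) (S⊆∁Z s v∈S) (u∈S , u-side)
          λ (_ , v≡s) → Bool.not-¬ v≡s v-side)
          where
          step : ∀ {y z} → y ∈ S × side y false ≡ s → Adj G (∁ (Z s)) y z → z ∈ S × side z false ≡ s
          step {y} {z} (y∈S , y-side) (_ , z∉Z , y~z) = z∈S ,
            trans (side-~ false (S⇒survives false z∈S) (S⇒survives true y∈S) (~-sym y~z))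
                  (trans (pure⁺ true false y∈S) y-side)
            where
            z∉Y : z ∉ Y
            z∉Y z∈Y = x∈∁p⇒x∉p z∉Z (Y⊆part X Y σ s z∈Y)

            -- The surviving copy of such a `z` would be adjacent to a copy of `y`, hence on side
            -- `s`, which puts `z` into `Z s`.
            z∉X : z ∉ X
            z∉X z∈X = x∈∁p⇒x∉p z∉Z (∈-part⁺ X Y σ z∈X
              (trans (side-~ (alive z) (Y∌⇒alive z∉Y) (S⇒survives _ y∈S) (~-sym y~z))
                     (trans (pure⁺ _ false y∈S) y-side)))

            z∈S = S⁺ z∉X z∉Y

    two-sided-bound : 2 * κ G ≤ ∣ W ∣ ⊎ b G ≤ ∣ W ∣
    two-sided-bound
      with any? (λ x → (x ∈? X) ×-dec ¬? (any? λ v → (v ∈? S) ×-dec (x ~? v)))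
         | any? (λ v → (v ∈? S) ×-dec ¬? (side v false Bool.≟ side v true))
    ... | yes (x , x∈X , iso) | _ = inj₂ (isolated-case x∈X λ v∈S x~v → iso (_ , v∈S , x~v))
    ... | no _ | yes (v , v-mixed) = inj₂ (mixed-case v-mixed)
    ... | no ¬isolated | no ¬mixed = inj₁ (pure-case
      (λ {x} x∈X → decidable-stable (any? λ v → (v ∈? S) ×-dec (x ~? v)) λ iso → ¬isolated (x , x∈X , iso))
      (λ {v} v∈S → decidable-stable (side v false Bool.≟ side v true) λ sides≢ → ¬mixed (v , v∈S , sides≢)))

  -- The lower bound for disconnecting cuts and for trivial remainders.

  disconnecting-bound : ∀ {W} → ¬ Connected (G ⊗ K₂) (∁ W) → 2 * κ G ≤ ∣ W ∣ ⊎ b G ≤ ∣ W ∣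
  disconnecting-bound {W} ¬conn
    with any? (λ p → any? λ q → (p ∈? ∁ W) ×-dec (q ∈? ∁ W) ×-dec ¬? (reach? (G ⊗ K₂) (∁ W) p q))
  ... | no none = contradiction
    (λ p q p∈ q∈ → decidable-stable (reach? (G ⊗ K₂) (∁ W) p q) λ ¬pq → none (p , q , p∈ , q∈ , ¬pq)) ¬conn
  ... | yes (p , q , p∈ , q∈ , ¬pq) = two-sided-bound W side side-~ side-onto
    where
    H = G ⊗ K₂

    side : Vertex → Bool → Bool
    -- One side is the component of `p`, the other is everything else; `q` shows that the latter has
    -- a surviving copy.
    side v b = does (reach? H (∁ W) p (v at b))

    side-~ : ∀ {u v} b → u at b ∉ W → v at not b ∉ W → u ~ v → side u b ≡ side v (not b)
    side-~ {u} {v} b u∉W v∉W u~v = does-⇔ (mk⇔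
      (_◅◅ (x∉p⇒x∈∁p u∉W , x∉p⇒x∈∁p v∉W , u~ᴷv) ◅ ε)
      (_◅◅ (x∉p⇒x∈∁p v∉W , x∉p⇒x∈∁p u∉W , Graph.~-sym H {u at b} {v at not b} u~ᴷv) ◅ ε))
      (reach? H (∁ W) p _) (reach? H (∁ W) p _)
      where u~ᴷv = ~ᴷ⁺ b u~v

    side-onto : ∀ s → ∃₂ λ v b → v at b ∉ W × side v b ≡ s
    side-onto true with at-surjective {order} p
    ... | v , b , refl = v , b , x∈∁p⇒x∉p p∈ , dec-true (reach? H (∁ W) (v at b) (v at b)) ε
    side-onto false with at-surjective {order} q
    ... | v , b , refl = v , b , x∈∁p⇒x∉p q∈ , dec-false (reach? H (∁ W) p (v at b)) ¬pq

  -- Here `W` has `2 * order - 1` elements, while keeping a single vertex `v` of `G` is a cut of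
  -- size `k = order - 1`, so the bound holds with one to spare.
  trivial-bound : ∀ {W} → Trivial (G ⊗ K₂) (∁ W) → 2 * κ G ≤ ∣ W ∣
  trivial-bound {W} ∣∁W∣≡1 with ∣p∣≡1⇒singleton {p = ∁ W} ∣∁W∣≡1
  ... | i , _ with at-surjective {order} i
  ... | v , _ = begin
    2 * κ G   ≤⟨ ℕ.*-monoʳ-≤ 2 (κ-≤ G {∁ ⁅ v ⁆} (inj₂ (ℕ.+-cancelˡ-≡ k _ _
      (trans (∣p∣+∣∁p∣≡n (∁ ⁅ v ⁆)) order≡)))) ⟩
    2 * k     ≤⟨ ℕ.n≤1+n (2 * k) ⟩
    1 + 2 * k ≡⟨ ℕ.suc-injective (begin-equality
      2 + 2 * k          ≡⟨ solve 1 (λ k → con 2 :+ con 2 :* k := (k :+ con 1) :* con 2) refl k ⟩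
      (k + 1) * 2        ≡⟨ cong (_* 2) order≡ ⟨
      order * 2          ≡⟨ ∣p∣+∣∁p∣≡n W ⟨
      ∣ W ∣ + ∣ ∁ W ∣    ≡⟨ cong (∣ W ∣ +_) ∣∁W∣≡1 ⟩
      ∣ W ∣ + 1          ≡⟨ ℕ.+-comm ∣ W ∣ 1 ⟩
      suc ∣ W ∣          ∎) ⟩
    ∣ W ∣     ∎
    where
    open ℕ.≤-Reasoning
    k = ∣ ∁ ⁅ v ⁆ ∣

    order≡ : order ≡ k + 1
    order≡ = trans (sym (∣p∣+∣∁p∣≡n ⁅ v ⁆)) (trans (cong (_+ k) (∣⁅x⁆∣≡1 v)) (ℕ.+-comm 1 k))

  cut-bound : ∀ {W} → IsCut (G ⊗ K₂) W → (2 * κ G) ⊓ b G ≤ ∣ W ∣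
  cut-bound {W} cut = [ ℕ.m≤n⇒m⊓o≤n (b G) , ℕ.m≤n⇒o⊓m≤n (2 * κ G) ]′
    ([ disconnecting-bound {W} , inj₁ ∘ trivial-bound {W} ]′ cut)

theorem1p1 : (G : Graph) → κ (G ⊗ K₂) ≡ (2 * κ G) ⊓ b G
theorem1p1 G = ℕ.≤-antisym (ℕ.⊓-glb κ≤2κ κ≤b) bound
  where
  κ≤2κ : κ (G ⊗ K₂) ≤ 2 * κ G
  κ≤2κ with κ-least G
  ... | k , (W , cut , refl) , _ = subst (κ (G ⊗ K₂) ≤_)
    (trans (∣layered∣ (λ _ → W)) (cong (∣ W ∣ +_) (sym (ℕ.+-identityʳ ∣ W ∣))))
    (κ-≤ (G ⊗ K₂) (doubled-isCut G cut))

  κ≤b : κ (G ⊗ K₂) ≤ b G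
  κ≤b with b-least G
  ... | k , (X , Y , bPair , refl) , _ with bPair-isCut G bPair
  ... | W , cut , ∣W∣≡ = subst (κ (G ⊗ K₂) ≤_) ∣W∣≡ (κ-≤ (G ⊗ K₂) cut)

  bound : (2 * κ G) ⊓ b G ≤ κ (G ⊗ K₂)
  bound with κ-least (G ⊗ K₂)
  ... | k , (W , cut , refl) , _ = cut-bound G cut
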